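{- Let $n\geq 8$ be an integer with $n\not\equiv 1\pmod 3$. Let $\widetilde{L}$ be the $n\times n$ matrix $$\widetilde{L}=\frac{n-1}{3}I_n-\frac13\begin{bmatrix}0&\mathbf{e}'\\ \mathbf{e}&\mathbf{0}\end{bmatrix}+\begin{bmatrix}0&\mathbf{0}'\\ \mathbf{0}&M\end{bmatrix},$$ where $M=\frac13\operatorname{Circ}(\bar{\mathbf{x}}')$ if $n\equiv 2\pmod 3$ and $M=\frac13\operatorname{Circ}(\bar{\mathbf{y}}')$ if $n\equiv 0\pmod 3$, with $\bar{\mathbf{x}},\bar{\mathbf{y}}\in\mathbb{R}^{n-1}$ given by $$\bar{\mathbf{x}}=(2-n,\underbrace{1,-2,1},\dots,\underbrace{1,-2,1})',\qquad \bar{\mathbf{y}}=(-n,\underbrace{2,-1,-1},\dots,\underbrace{2,-1,-1},2)'.$$ Then $\widetilde{L}$ is a Laplacian-like matrix.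
   Context: A real square matrix $A$ is called Laplacian-like if $A\mathbf{e}=0$ and $\mathbf{e}'A=0$, where $\mathbf{e}$ is the all-ones column vector of the appropriate size. The prime denotes transpose and $I_n$ is the identity matrix. In the block matrices the blocks have sizes $1$ and $n-1$, and $\mathbf{e}$ there lies in $\mathbb{R}^{n-1}$. For a vector $\mathbf{c}=(c_1,\dots,c_m)'$, $\operatorname{Circ}(\mathbf{c}')$ is the $m\times m$ circulant matrix with first row $(c_1,\dots,c_m)$ and each subsequent row the cyclic right shift by one of the previous row. -}

module Defs where

open import Data.Fin.Base using (Fin; zero; suc; toℕ; fromℕ; inject₁)
open import Data.Fin.Properties using (_≟_)
open import Data.Integer.Base using (+_)
open import Data.Nat.Base using (ℕ; zero; suc; _∸_; _%_)
open import Data.Nat.GeneralisedArithmetic using (fold)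
open import Data.Product.Base using (_×_)
open import Data.Rational.Base using (ℚ; 0ℚ; 1ℚ; _+_; _-_; _*_; -_; _/_)
open import Data.Rational.Properties using (+-0-commutativeMonoid)
open import Data.Bool.Base using (if_then_else_)
open import Data.Vec.Functional using (Vector; []; _∷_; replicate)
open import Relation.Binary.PropositionalEquality.Core using (_≡_)
open import Relation.Nullary.Decidable.Core using (does)

open import Algebra.Properties.CommutativeMonoid.Sum +-0-commutativeMonoid
  using (sum)

-- The real matrices considered here have rational entries, and the equations
-- below hold in ℝ iff they hold in ℚ, so ℚ serves as the field of scalars.

Matrix : ℕ → ℕ → Set
Matrix m n = Fin m → Fin n → ℚ

infixl 6 _+ᴹ_ _-ᴹ_
infixr 7 _·ᴹ_
infix  8 _*ᵛ_ _ᵛ*_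

_+ᴹ_ _-ᴹ_ : ∀ {m n} → Matrix m n → Matrix m n → Matrix m n
(A +ᴹ B) i j = A i j + B i j
(A -ᴹ B) i j = A i j - B i j

_·ᴹ_ : ∀ {m n} → ℚ → Matrix m n → Matrix m n
(c ·ᴹ A) i j = c * A i j

_*ᵛ_ : ∀ {m n} → Matrix m n → Vector ℚ n → Vector ℚ m
(A *ᵛ v) i = sum (λ j → A i j * v j)

_ᵛ*_ : ∀ {m n} → Vector ℚ m → Matrix m n → Vector ℚ n
(v ᵛ* A) j = sum (λ i → v i * A i j)

𝟎ᴹ : ∀ {m n} → Matrix m n
𝟎ᴹ i j = 0ℚ

𝕀 : ∀ n → Matrix n n
𝕀 n i j = if does (i ≟ j) then 1ℚ else 0ℚ

𝟎 : ∀ n → Vector ℚ n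
𝟎 n = replicate n 0ℚ

𝐞 : ∀ n → Vector ℚ n
𝐞 n = replicate n 1ℚ

LaplacianLike : ∀ {n} → Matrix n n → Set
LaplacianLike {n} A =
  (∀ i → (A *ᵛ 𝐞 n) i ≡ 0ℚ) × (∀ j → (𝐞 n ᵛ* A) j ≡ 0ℚ)

-- block a r c D is the matrix with block rows [ a , r′ ] and [ c , D ].
block : ∀ {m n} → ℚ → Vector ℚ n → Vector ℚ m → Matrix m n →
        Matrix (suc m) (suc n)
block a r c D zero    zero    = a
block a r c D zero    (suc j) = r j
block a r c D (suc i) zero    = c i
block a r c D (suc i) (suc j) = D i j

-- (c₁ , … , cₘ) ↦ (cₘ , c₁ , … , cₘ₋₁)
shiftʳ : ∀ {m} → Vector ℚ m → Vector ℚ m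
shiftʳ {suc m} c zero    = c (fromℕ m)
shiftʳ {suc m} c (suc j) = c (inject₁ j)

Circ : ∀ {m} → Vector ℚ m → Matrix m m
Circ c i = fold c shiftʳ (toℕ i)

-- (p , q , r , p , q , r , …), cut off at the length of the vector.
cycle : ∀ {m} → ℚ → ℚ → ℚ → Vector ℚ m
cycle p q r zero    = p
cycle p q r (suc i) = cycle q r p i

ℕ→ℚ : ℕ → ℚ
ℕ→ℚ n = + n / 1

2ℚ ⅓ : ℚ
2ℚ = + 2 / 1
⅓  = + 1 / 3

-- For n ≡ 2 (mod 3) the n ∸ 2 entries after the first form complete groups
-- 1 , -2 , 1.  The vector is empty for n < 2.
x̄ : ∀ n → Vector ℚ (n ∸ 1)
x̄ zero            = []
x̄ (suc zero)      = []
x̄ n@(suc (suc _)) = (2ℚ - ℕ→ℚ n) ∷ cycle 1ℚ (- 2ℚ) 1ℚ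

-- For n ≡ 0 (mod 3) the n ∸ 2 entries after the first form complete groups
-- 2 , -1 , -1 followed by a single 2.  The vector is empty for n < 2.
ȳ : ∀ n → Vector ℚ (n ∸ 1)
ȳ zero            = []
ȳ (suc zero)      = []
ȳ n@(suc (suc _)) = (- ℕ→ℚ n) ∷ cycle 2ℚ (- 1ℚ) (- 1ℚ)

-- The value for n ≡ 1 (mod 3) is a dummy.
M : ∀ n → Matrix (n ∸ 1) (n ∸ 1)
M n with n % 3
... | 2 = ⅓ ·ᴹ Circ (x̄ n)
... | 0 = ⅓ ·ᴹ Circ (ȳ n)
... | _ = 𝟎ᴹ

-- The block form needs n ≥ 1; there is only one 0 × 0 matrix.
L̃ : ∀ n → Matrix n n
L̃ zero      = 𝟎ᴹ
L̃ n@(suc m) =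
     ((ℕ→ℚ n - 1ℚ) * ⅓) ·ᴹ 𝕀 n
  -ᴹ ⅓ ·ᴹ block 0ℚ (𝐞 m) (𝐞 m) 𝟎ᴹ
  +ᴹ block 0ℚ (𝟎 m) (𝟎 m) (M n)

{-# OPTIONS --safe #-}

-- The bordered matrix L̃ is Laplacian-like as soon as every row and column of
-- its lower right block M sums to (2 − n)/3.  Each row of a circulant matrix is
-- a rotation of its first row; its first column is the first row in reverse up
-- to rotation, and each further column is a rotation of the previous one.  So
-- it remains to see that x̄ and ȳ both sum to 2 − n, which holds because the
-- groups 1 , −2 , 1 and 2 , −1 , −1 cancel.

module Submission where

open import Defs
open import Data.Fin.Base using (Fin; zero; suc; toℕ; fromℕ; inject₁; opposite)
open import Data.Fin.Induction using (<-weakInduction)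
open import Data.Fin.Permutation using (reverse)
open import Data.Fin.Properties
  using (toℕ-injective; toℕ-inject₁; toℕ-fromℕ; toℕ<n; opposite-prop)
import Data.Integer.Base as ℤ
import Data.Integer.Properties as ℤ
open import Data.Nat.Base as ℕ using (ℕ; zero; suc; _≤_; _∸_; _%_; s≤s)
open import Data.Nat.DivMod using (m%n<n)
open import Data.Nat.GeneralisedArithmetic using (fold; fold-+)
import Data.Nat.Properties as ℕ
open import Data.Product.Base using (_×_; _,_; proj₁; proj₂)
open import Data.Rational.Base using (ℚ; 0ℚ; 1ℚ; _+_; _-_; _*_; -_; toℚᵘ)
open import Data.Rational.Properties
  using ( +-*-commutativeRing; +-0-commutativeMonoid; +-comm; *-comm
        ; +-identityʳ; _≟_; toℚᵘ-injective; toℚᵘ-homo-+; toℚᵘ-fromℚᵘ )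
open import Data.Rational.Unnormalised.Base as ℚᵘ using (mkℚᵘ; *≡*)
import Data.Rational.Unnormalised.Properties as ℚᵘ
open import Data.Vec.Functional using (Vector)
open import Function.Base using (flip)
open import Relation.Binary.PropositionalEquality
  using (_≡_; _≢_; refl; sym; trans; cong; cong₂; module ≡-Reasoning)
open import Relation.Nullary.Decidable.Core using (dec⇒maybe)
open import Relation.Nullary.Negation using (contradiction)
open import Tactic.RingSolver using (solve-∀)
open import Tactic.RingSolver.Core.AlmostCommutativeRing
  using (AlmostCommutativeRing; fromCommutativeRing)

open import Algebra.Bundles using (CommutativeRing)
open import Algebra.Properties.CommutativeMonoid.Sum +-0-commutativeMonoid
  using (sum; sum-cong-≗; sum-replicate-zero; sum-init-last; sum-permute; ∑-distrib-+)
open import Algebra.Properties.Semiring.Sum (CommutativeRing.semiring +-*-commutativeRing)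
  using (*-distribˡ-sum)

open ≡-Reasoning

ℚ-ring : AlmostCommutativeRing _ _
ℚ-ring = fromCommutativeRing +-*-commutativeRing (λ x → dec⇒maybe (0ℚ ≟ x))

-- The gcd normalisation in `_/_` is stuck on a variable `n`. Unnormalised rationals avoid it: there
-- this is addition of numerators over denominator 1.
ℕ→ℚ-suc : ∀ n → ℕ→ℚ (suc n) ≡ 1ℚ + ℕ→ℚ n
ℕ→ℚ-suc n = toℚᵘ-injective (begin-equality
  toℚᵘ (ℕ→ℚ (suc n))            ≃⟨ toℚᵘ-fromℚᵘ (mkℚᵘ (ℤ.+ suc n) 0) ⟩
  mkℚᵘ (ℤ.+ suc n) 0            ≃⟨ *≡* (cong (λ k → (ℤ.+ 1 ℤ.+ k) ℤ.* ℤ.+ 1) (sym (ℤ.*-identityʳ (ℤ.+ n)))) ⟩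
  mkℚᵘ (ℤ.+ 1) 0 ℚᵘ.+ mkℚᵘ (ℤ.+ n) 0 ≃⟨ ℚᵘ.+-congʳ (mkℚᵘ (ℤ.+ 1) 0) (ℚᵘ.≃-sym (toℚᵘ-fromℚᵘ (mkℚᵘ (ℤ.+ n) 0))) ⟩
  toℚᵘ 1ℚ ℚᵘ.+ toℚᵘ (ℕ→ℚ n)     ≃⟨ ℚᵘ.≃-sym (toℚᵘ-homo-+ 1ℚ (ℕ→ℚ n)) ⟩
  toℚᵘ (1ℚ + ℕ→ℚ n)             ∎ᵘ)
  where open ℚᵘ.≤-Reasoning renaming (_∎ to _∎ᵘ)

sum-replicate-1 : ∀ n → sum (𝐞 n) ≡ ℕ→ℚ n
sum-replicate-1 zero    = refl
sum-replicate-1 (suc n) = trans (cong (1ℚ +_) (sum-replicate-1 n)) (sym (ℕ→ℚ-suc n))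

-- Row and column sums of circulant matrices.

fold-shiftʳ : ∀ {m} (c : Vector ℚ m) k {i j} → toℕ i ≡ k ℕ.+ toℕ j →
              fold c shiftʳ k i ≡ c j
fold-shiftʳ c zero            eq = cong c (toℕ-injective eq)
-- `eq` rules out index `zero`, so the outermost shift reads the preceding entry and does not wrap
-- around.
fold-shiftʳ c (suc k) {suc i} eq =
  fold-shiftʳ c k (trans (toℕ-inject₁ i) (ℕ.suc-injective eq))

-- The first `k` shifts carry `c j` to the last position `m`; one more moves it to the front.
fold-shiftʳ-wrap : ∀ {m} (c : Vector ℚ (suc m)) k {j} → m ≡ k ℕ.+ toℕ j →
                   fold c shiftʳ (suc k) zero ≡ c j
fold-shiftʳ-wrap {m} c k eq = fold-shiftʳ c k (trans (toℕ-fromℕ m) eq)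

-- With `m = toℕ j + suc r`, the first `suc r` shifts bring `c (suc j)` round to the front and the
-- other `toℕ j` carry it on to position `j`. Thus `m` right shifts of `m + 1` entries act as one
-- left shift.
fold-shiftʳ-period : ∀ {m} (c : Vector ℚ (suc m)) (j : Fin m) →
                     fold c shiftʳ m (inject₁ j) ≡ c (suc j)
fold-shiftʳ-period {m} c j = begin
  fold c shiftʳ m (inject₁ j)
    ≡⟨ cong (λ k → fold c shiftʳ k (inject₁ j)) (trans (ℕ.+-suc (toℕ j) r) (ℕ.m+[n∸m]≡n (toℕ<n j))) ⟨
  fold c shiftʳ (toℕ j ℕ.+ suc r) (inject₁ j)
    ≡⟨ cong (λ v → v (inject₁ j)) (fold-+ c shiftʳ (toℕ j)) ⟩
  fold (fold c shiftʳ (suc r)) shiftʳ (toℕ j) (inject₁ j)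
    ≡⟨ fold-shiftʳ (fold c shiftʳ (suc r)) (toℕ j) {j = zero}
         (trans (toℕ-inject₁ j) (sym (ℕ.+-identityʳ (toℕ j)))) ⟩
  fold c shiftʳ (suc r) zero
    ≡⟨ fold-shiftʳ-wrap c r (sym (ℕ.m∸n+n≡m (toℕ<n j))) ⟩
  c (suc j) ∎
  where r = m ∸ suc (toℕ j)

sum-shiftʳ : ∀ {m} (c : Vector ℚ m) → sum (shiftʳ c) ≡ sum c
sum-shiftʳ {zero}  c = refl
sum-shiftʳ {suc m} c = trans (+-comm (c (fromℕ m)) _) (sym (sum-init-last c))

sum-Circ-row : ∀ {m} (c : Vector ℚ m) i → sum (Circ c i) ≡ sum c
sum-Circ-row c i = go (toℕ i)
  where
  go : ∀ k → sum (fold c shiftʳ k) ≡ sum c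
  go zero    = refl
  go (suc k) = trans (sum-shiftʳ (fold c shiftʳ k)) (go k)

sum-Circ-column : ∀ {m} (c : Vector ℚ m) j → sum (flip (Circ c) j) ≡ sum c
sum-Circ-column {suc m} c = <-weakInduction (λ j → sum (flip (Circ c) j) ≡ sum c) first next
  where
  first : sum (flip (Circ c) zero) ≡ sum c
  first = cong (λ s → c zero + s) (begin
    sum (λ (i : Fin m) → fold c shiftʳ (suc (toℕ i)) zero)
      -- Below its top entry, the first column lists the tail of `c` backwards, hence the
      -- permutation `reverse`.
      ≡⟨ sum-cong-≗ (λ i → fold-shiftʳ-wrap c (toℕ i) (sym (eq i))) ⟩
    sum (λ (i : Fin m) → c (suc (opposite i)))
      ≡⟨ sum-permute (λ (i : Fin m) → c (suc i)) reverse ⟨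
    sum (λ (i : Fin m) → c (suc i)) ∎)
    where
    eq : ∀ i → toℕ i ℕ.+ suc (toℕ (opposite i)) ≡ m
    eq i = begin
      toℕ i ℕ.+ suc (toℕ (opposite i)) ≡⟨ ℕ.+-suc (toℕ i) _ ⟩
      suc (toℕ i) ℕ.+ toℕ (opposite i) ≡⟨ cong (suc (toℕ i) ℕ.+_) (opposite-prop i) ⟩
      suc (toℕ i) ℕ.+ (m ∸ suc (toℕ i)) ≡⟨ ℕ.m+[n∸m]≡n (toℕ<n i) ⟩
      m ∎

  -- Column `suc j` is `c (suc j)` followed by column `j` without its last entry. By
  -- `fold-shiftʳ-period` that last entry is `c (suc j)` as well, so the sum is unchanged.
  next : ∀ j → sum (flip (Circ c) (inject₁ j)) ≡ sum c → sum (flip (Circ c) (suc j)) ≡ sum c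
  next j ih = begin
    c (suc j) + sum (λ (i : Fin m) → fold c shiftʳ (toℕ i) (inject₁ j))
      ≡⟨ +-comm (c (suc j)) _ ⟩
    sum (λ (i : Fin m) → fold c shiftʳ (toℕ i) (inject₁ j)) + c (suc j)
      ≡⟨ cong₂ _+_
           (sum-cong-≗ (λ (i : Fin m) → cong (λ k → fold c shiftʳ k (inject₁ j)) (toℕ-inject₁ i)))
           (trans (cong (λ k → fold c shiftʳ k (inject₁ j)) (toℕ-fromℕ m)) (fold-shiftʳ-period c j)) ⟨
    sum (λ (i : Fin m) → Circ c (inject₁ i) (inject₁ j)) + Circ c (fromℕ m) (inject₁ j)
      ≡⟨ sum-init-last (flip (Circ c) (inject₁ j)) ⟨
    sum (flip (Circ c) (inject₁ j))
      ≡⟨ ih ⟩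
    sum c ∎

sum-·Circ : ∀ {m} a (c : Vector ℚ m) {s} → sum c ≡ s →
            (∀ i → sum ((a ·ᴹ Circ c) i) ≡ a * s) ×
            (∀ j → sum (flip (a ·ᴹ Circ c) j) ≡ a * s)
sum-·Circ a c refl =
  (λ i → trans (sym (*-distribˡ-sum a (Circ c i))) (cong (a *_) (sum-Circ-row c i))) ,
  (λ j → trans (sym (*-distribˡ-sum a (flip (Circ c) j))) (cong (a *_) (sum-Circ-column c j)))

-- Sums of the first rows and of `M`.

sum-cycle₀ : ∀ l {p q r} → p + (q + r) ≡ 0ℚ → l % 3 ≡ 0 → sum (cycle {l} p q r) ≡ 0ℚ
sum-cycle₀ zero                p+q+r≡0 l%3≡0 = refl
-- Both `cycle` and `_% 3` come back to themselves after three steps by computation, so the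
-- hypotheses pass to `l` unchanged.
sum-cycle₀ (suc (suc (suc l))) {p} {q} {r} p+q+r≡0 l%3≡0 = begin
  p + (q + (r + sum (cycle {l} p q r))) ≡⟨ cong (λ s → p + (q + (r + s))) (sum-cycle₀ l p+q+r≡0 l%3≡0) ⟩
  p + (q + (r + 0ℚ))                    ≡⟨ cong (λ s → p + (q + s)) (+-identityʳ r) ⟩
  p + (q + r)                           ≡⟨ p+q+r≡0 ⟩
  0ℚ ∎

-- The complete groups cancel, and the one entry left over starts a new group, so it is `p`.
sum-cycle₁ : ∀ l {p q r} → p + (q + r) ≡ 0ℚ → l % 3 ≡ 1 → sum (cycle {l} p q r) ≡ p
sum-cycle₁ (suc zero)          {p} p+q+r≡0 l%3≡1 = +-identityʳ p
sum-cycle₁ (suc (suc (suc l))) {p} {q} {r} p+q+r≡0 l%3≡1 = begin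
  p + (q + (r + sum (cycle {l} p q r))) ≡⟨ cong (λ s → p + (q + (r + s))) (sum-cycle₁ l p+q+r≡0 l%3≡1) ⟩
  p + (q + (r + p))                     ≡⟨ rotate p q r ⟩
  p + (q + r) + p                       ≡⟨ cong (_+ p) p+q+r≡0 ⟩
  0ℚ + p                                ≡⟨ +-comm 0ℚ p ⟩
  p + 0ℚ                                ≡⟨ +-identityʳ p ⟩
  p ∎
  where
  rotate : ∀ p q r → p + (q + (r + p)) ≡ p + (q + r) + p
  rotate = solve-∀ ℚ-ring

[2+l]%3≡2⇒l%3≡0 : ∀ l → (2 ℕ.+ l) % 3 ≡ 2 → l % 3 ≡ 0
[2+l]%3≡2⇒l%3≡0 zero                eq = refl
[2+l]%3≡2⇒l%3≡0 (suc (suc (suc l))) eq = [2+l]%3≡2⇒l%3≡0 l eq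

[2+l]%3≡0⇒l%3≡1 : ∀ l → (2 ℕ.+ l) % 3 ≡ 0 → l % 3 ≡ 1
[2+l]%3≡0⇒l%3≡1 (suc zero)          eq = refl
[2+l]%3≡0⇒l%3≡1 (suc (suc (suc l))) eq = [2+l]%3≡0⇒l%3≡1 l eq

sum-x̄ : ∀ l → (2 ℕ.+ l) % 3 ≡ 2 → sum (x̄ (2 ℕ.+ l)) ≡ 2ℚ - ℕ→ℚ (2 ℕ.+ l)
sum-x̄ l eq = trans
  (cong ((2ℚ - ℕ→ℚ (2 ℕ.+ l)) +_) (sum-cycle₀ l refl ([2+l]%3≡2⇒l%3≡0 l eq)))
  (+-identityʳ _)

-- The final unpaired 2 turns the leading -n into 2 - n.
sum-ȳ : ∀ l → (2 ℕ.+ l) % 3 ≡ 0 → sum (ȳ (2 ℕ.+ l)) ≡ 2ℚ - ℕ→ℚ (2 ℕ.+ l)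
sum-ȳ l eq = trans
  (cong (- ℕ→ℚ (2 ℕ.+ l) +_) (sum-cycle₁ l refl ([2+l]%3≡0⇒l%3≡1 l eq)))
  (+-comm (- ℕ→ℚ (2 ℕ.+ l)) 2ℚ)

sum-M : ∀ l → (2 ℕ.+ l) % 3 ≢ 1 →
        (∀ i → sum (M (2 ℕ.+ l) i) ≡ ⅓ * (2ℚ - ℕ→ℚ (2 ℕ.+ l))) ×
        (∀ j → sum (flip (M (2 ℕ.+ l)) j) ≡ ⅓ * (2ℚ - ℕ→ℚ (2 ℕ.+ l)))
-- Abstracting the remainder lets `M` unfold in each case; the bound from `m%n<n` excludes
-- remainders of 3 and more.
sum-M l n%3≢1 with (2 ℕ.+ l) % 3 in eq | m%n<n (2 ℕ.+ l) 3
... | 0 | _ = sum-·Circ ⅓ (ȳ (2 ℕ.+ l)) (sum-ȳ l eq)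
... | 1 | _ = contradiction refl n%3≢1
... | 2 | _ = sum-·Circ ⅓ (x̄ (2 ℕ.+ l)) (sum-x̄ l eq)
... | suc (suc (suc _)) | s≤s (s≤s (s≤s ()))

-- The bordered matrix.

sum-𝕀-row : ∀ {n} (i : Fin n) → sum (𝕀 n i) ≡ 1ℚ
sum-𝕀-row {suc n} zero    = cong (1ℚ +_) (sum-replicate-zero n)
sum-𝕀-row {suc n} (suc i) = cong (0ℚ +_) (sum-𝕀-row i)

𝕀-sym : ∀ {n} (i j : Fin n) → 𝕀 n i j ≡ 𝕀 n j i
𝕀-sym zero    zero    = refl
𝕀-sym zero    (suc j) = refl
𝕀-sym (suc i) zero    = refl
𝕀-sym (suc i) (suc j) = 𝕀-sym i j

-- `L̃ (suc m)` unfolds to this at `D = M (suc m)`. Keeping `D` free allows it to be replaced by its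
-- transpose.
bordered : ∀ {m} → Matrix m m → Matrix (suc m) (suc m)
bordered {m} D =
     ((ℕ→ℚ (suc m) - 1ℚ) * ⅓) ·ᴹ 𝕀 (suc m)
  -ᴹ ⅓ ·ᴹ block 0ℚ (𝐞 m) (𝐞 m) 𝟎ᴹ
  +ᴹ block 0ℚ (𝟎 m) (𝟎 m) D

-- All summands other than `D` are symmetric. Column sums thereby become row sums of
-- `bordered (flip D)`.
bordered-transpose : ∀ {m} (D : Matrix m m) i j → bordered D i j ≡ bordered (flip D) j i
bordered-transpose D zero    zero    = refl
bordered-transpose D zero    (suc j) = refl
bordered-transpose D (suc i) zero    = refl
bordered-transpose {m} D (suc i) (suc j) =
  cong (λ d → (ℕ→ℚ (suc m) - 1ℚ) * ⅓ * d - ⅓ * 0ℚ + D i j) (𝕀-sym i j)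

bordered-*ᵛ : ∀ {m} (D : Matrix m m) →
              (∀ i → sum (D i) ≡ ⅓ * (2ℚ - ℕ→ℚ (suc m))) →
              ∀ i → (bordered D *ᵛ 𝐞 (suc m)) i ≡ 0ℚ
-- With n = m + 1, the corner (n - 1)/3 balances m border entries -1/3.
bordered-*ᵛ {m} D rows zero = begin
  (α * 1ℚ - ⅓ * 0ℚ + 0ℚ) * 1ℚ + sum {m} (λ _ → (α * 0ℚ - ⅓ * 1ℚ + 0ℚ) * 1ℚ)
    ≡⟨ cong ((α * 1ℚ - ⅓ * 0ℚ + 0ℚ) * 1ℚ +_)
            (trans (sum-cong-≗ (λ (_ : Fin m) → lemma₁ α ⅓)) (sym (*-distribˡ-sum (- ⅓) (𝐞 m)))) ⟩
  (α * 1ℚ - ⅓ * 0ℚ + 0ℚ) * 1ℚ + - ⅓ * sum (𝐞 m)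
    ≡⟨ cong ((α * 1ℚ - ⅓ * 0ℚ + 0ℚ) * 1ℚ +_) (cong (- ⅓ *_) (sum-replicate-1 m)) ⟩
  (α * 1ℚ - ⅓ * 0ℚ + 0ℚ) * 1ℚ + - ⅓ * ℕ→ℚ m
    ≡⟨ cong (λ N → ((N - 1ℚ) * ⅓ * 1ℚ - ⅓ * 0ℚ + 0ℚ) * 1ℚ + - ⅓ * ℕ→ℚ m) (ℕ→ℚ-suc m) ⟩
  ((1ℚ + ℕ→ℚ m - 1ℚ) * ⅓ * 1ℚ - ⅓ * 0ℚ + 0ℚ) * 1ℚ + - ⅓ * ℕ→ℚ m
    ≡⟨ lemma₂ (ℕ→ℚ m) ⅓ ⟩
  0ℚ ∎
  where
  α = (ℕ→ℚ (suc m) - 1ℚ) * ⅓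
  lemma₁ : ∀ a t → (a * 0ℚ - t * 1ℚ + 0ℚ) * 1ℚ ≡ - t * 1ℚ
  lemma₁ = solve-∀ ℚ-ring
  lemma₂ : ∀ N t → ((1ℚ + N - 1ℚ) * t * 1ℚ - t * 0ℚ + 0ℚ) * 1ℚ + - t * N ≡ 0ℚ
  lemma₂ = solve-∀ ℚ-ring
-- Border, diagonal and `D` contribute -1/3 + (n - 1)/3 + (2 - n)/3 = 0.
bordered-*ᵛ {m} D rows (suc i) = begin
  (α * 0ℚ - ⅓ * 1ℚ + 0ℚ) * 1ℚ + sum (λ j → (α * 𝕀 m i j - ⅓ * 0ℚ + D i j) * 1ℚ)
    ≡⟨ cong (λ s → (α * 0ℚ - ⅓ * 1ℚ + 0ℚ) * 1ℚ + s) (begin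
         sum (λ j → (α * 𝕀 m i j - ⅓ * 0ℚ + D i j) * 1ℚ)
           ≡⟨ sum-cong-≗ (λ j → lemma₁ α ⅓ (𝕀 m i j) (D i j)) ⟩
         sum (λ j → α * 𝕀 m i j + D i j)
           ≡⟨ ∑-distrib-+ (λ j → α * 𝕀 m i j) (D i) ⟩
         sum (λ j → α * 𝕀 m i j) + sum (D i)
           ≡⟨ cong₂ _+_ (trans (sym (*-distribˡ-sum α (𝕀 m i))) (cong (α *_) (sum-𝕀-row i))) (rows i) ⟩
         α * 1ℚ + ⅓ * (2ℚ - ℕ→ℚ (suc m)) ∎) ⟩
  -- `2ℚ` becomes `1ℚ + 1ℚ` by evaluation, to match the ring identity `lemma₂`.
  (α * 0ℚ - ⅓ * 1ℚ + 0ℚ) * 1ℚ + (α * 1ℚ + ⅓ * ((1ℚ + 1ℚ) - ℕ→ℚ (suc m)))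
    ≡⟨ lemma₂ (ℕ→ℚ (suc m)) ⅓ ⟩
  0ℚ ∎
  where
  α = (ℕ→ℚ (suc m) - 1ℚ) * ⅓
  lemma₁ : ∀ a t d e → (a * d - t * 0ℚ + e) * 1ℚ ≡ a * d + e
  lemma₁ = solve-∀ ℚ-ring
  lemma₂ : ∀ N t → ((N - 1ℚ) * t * 0ℚ - t * 1ℚ + 0ℚ) * 1ℚ
                   + ((N - 1ℚ) * t * 1ℚ + t * ((1ℚ + 1ℚ) - N)) ≡ 0ℚ
  lemma₂ = solve-∀ ℚ-ring

bordered-LaplacianLike : ∀ {m} (D : Matrix m m) →
  (∀ i → sum (D i) ≡ ⅓ * (2ℚ - ℕ→ℚ (suc m))) →
  (∀ j → sum (flip D j) ≡ ⅓ * (2ℚ - ℕ→ℚ (suc m))) →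
  LaplacianLike (bordered D)
bordered-LaplacianLike D rows columns =
  bordered-*ᵛ D rows ,
  λ j → trans
    (sum-cong-≗ (λ i → trans (*-comm 1ℚ (bordered D i j)) (cong (_* 1ℚ) (bordered-transpose D i j))))
    (bordered-*ᵛ (flip D) columns j)

theorem5p12 : (n : ℕ) → 8 ≤ n → n % 3 ≢ 1 → LaplacianLike (L̃ n)
theorem5p12 (suc zero)    (s≤s ())
theorem5p12 (suc (suc l)) 8≤n n%3≢1 =
  bordered-LaplacianLike (M (2 ℕ.+ l)) (proj₁ (sum-M l n%3≢1)) (proj₂ (sum-M l n%3≢1))
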